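{- Let $U$ be a graph that is universal for the class of locally finite graphs with path-width $1$. Then $U$ has path-width $\infty$.
   Context: All graphs (including universal graphs) are simple and countable (the vertex set is finite or countably infinite). A graph $U$ contains a graph $G$ if a subgraph (not necessarily induced) of $U$ is isomorphic to $G$. A graph $U$ is universal for a graph class $\mathcal{G}$ if $U$ contains every graph in $\mathcal{G}$ ($U$ need not be in $\mathcal{G}$). A graph is locally finite if every vertex has finite degree. A path-decomposition of a graph $G$ is a sequence $(B_t:t\in\mathbb{N})$ of subsets of $V(G)$ (bags) such that: $\bigcup_{t}B_t=V(G)$; for each edge $vw\in E(G)$ there is $t\in\mathbb{N}$ with $v,w\in B_t$; and $B_{t_1}\cap B_{t_3}\subseteq B_{t_2}$ whenever $t_1\leq t_2\leq t_3$. Its width is $\sup_{t\in\mathbb{N}}(|B_t|-1)$. The path-width of $G$ is the minimum width of a path-decomposition of $G$ (it is $\infty$ if every path-decomposition has bags of unbounded size). -}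

module Defs where

open import Data.Fin using (Fin)
open import Data.List using (List; length)
open import Data.List.Relation.Unary.All using (All)
open import Data.List.Relation.Unary.Unique.Propositional using (Unique)
open import Data.Nat using (ℕ; suc; _≤_)
open import Data.Product using (Σ; ∃; ∃-syntax; _×_)
open import Data.Sum using (_⊎_)
open import Function using (Injective; _↔_; _⇔_)
open import Level using (0ℓ) renaming (suc to lsuc)
open import Relation.Binary.Core using (Rel; _⇒_)
open import Relation.Binary.Definitions using (Symmetric)
open import Relation.Binary.PropositionalEquality using (_≡_)
open import Relation.Nullary using (¬_)
open import Relation.Nullary.Negation using (DoubleNegation)
open import Relation.Unary using (Pred; _∈_)

record Graph : Set₁ where
  field
    V         : Set
    Adj       : Rel V 0ℓ
    sym       : Symmetric Adj
    loopless  : ∀ v → ¬ Adj v v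
    countable : (∃[ n ] (V ↔ Fin n)) ⊎ (V ↔ ℕ)

record Subgraph (H : Graph) : Set₁ where
  open Graph H
  field
    vertices : Pred V 0ℓ
    edges    : Rel V 0ℓ
    edges⊆   : edges ⇒ Adj
    edges-sym : Symmetric edges
    incident : ∀ {u v} → edges u v → u ∈ vertices

-- An isomorphism onto a subgraph is given by its underlying map into the host
-- graph, so that no equality between elements of Σ V vertices is involved.
record IsomorphicTo (G : Graph) {H : Graph} (S : Subgraph H) : Set where
  open Subgraph S
  field
    to        : Graph.V G → Graph.V H
    injective : Injective _≡_ _≡_ to
    image     : ∀ w → w ∈ vertices ⇔ (∃[ v ] to v ≡ w)
    adjacency : ∀ u v → Graph.Adj G u v ⇔ edges (to u) (to v)

Contains : Graph → Graph → Set₁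
Contains U G = Σ (Subgraph U) (IsomorphicTo G)

GraphClass : Set₂
GraphClass = Pred Graph (lsuc 0ℓ)

UniversalFor : Graph → GraphClass → Set₁
UniversalFor U 𝒢 = ∀ G → G ∈ 𝒢 → Contains U G

-- |P| ≤ n.  The elements of P need not be enumerable, so the bound is on the
-- number of pairwise distinct elements that can be exhibited.
Card≤ : {A : Set} → Pred A 0ℓ → ℕ → Set
Card≤ {A} P n = (xs : List A) → Unique xs → All P xs → length xs ≤ n

-- Finiteness of a set is taken without a computed bound on its size, as in
-- classical mathematics; under excluded middle the double negation is void.
Finite : {A : Set} → Pred A 0ℓ → Set
Finite P = DoubleNegation (∃[ n ] Card≤ P n)

LocallyFinite : Graph → Set
LocallyFinite G = ∀ v → Finite (Adj v)
  where open Graph G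

record PathDecomposition (G : Graph) : Set₁ where
  open Graph G
  field
    bag      : ℕ → Pred V 0ℓ
    covers-V : ∀ v → ∃[ t ] v ∈ bag t
    covers-E : ∀ {v w} → Adj v w → ∃[ t ] (v ∈ bag t × w ∈ bag t)
    interval : ∀ {t₁ t₂ t₃} → t₁ ≤ t₂ → t₂ ≤ t₃ →
               ∀ {v} → v ∈ bag t₁ → v ∈ bag t₃ → v ∈ bag t₂

module _ {G : Graph} (D : PathDecomposition G) where
  open PathDecomposition D

  BagSizes≤ : ℕ → Set
  BagSizes≤ s = ∀ t → Card≤ (bag t) s

  -- The supremum of |bag t| is w + 1, i.e. that of |bag t| - 1 is w.
  HasWidth : ℕ → Set
  HasWidth w = BagSizes≤ (suc w) × (∀ s → BagSizes≤ s → suc w ≤ s)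

  UnboundedBags : Set
  UnboundedBags = ¬ (∃[ s ] BagSizes≤ s)

HasPathWidth : Graph → ℕ → Set₁
HasPathWidth G w =
  (Σ (PathDecomposition G) λ D → HasWidth D w) ×
  (∀ (D : PathDecomposition G) w′ → HasWidth D w′ → w ≤ w′)

HasInfinitePathWidth : Graph → Set₁
HasInfinitePathWidth G = (D : PathDecomposition G) → UnboundedBags D

{-# OPTIONS --safe #-}

-- Suppose U has a path-decomposition with bags of size at most s.  At most s
-- vertices are persistent, i.e. lie in all late bags; every other vertex has
-- all its neighbours in an initial segment of the decomposition.  Let F g bound
-- the time by which all non-persistent vertices occurring before time g have
-- left.  Take a one-way infinite caterpillar whose m-th vertex, if it lies on
-- the spine, has more than s * F^(m+1)(m) neighbours.  Any copy of it in U has a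
-- tail without persistent vertices, whose vertices m occur before time
-- F^m(t₀) ≤ F^m(m) for m ≥ t₀.  So the neighbours of such a spine vertex m all
-- lie in the first F^(m+1)(m) bags, which is too little room.
--
-- None of this is computable, so F is only a relation Out, and the caterpillar
-- is a graph on ℕ whose spine is given by a predicate: every vertex n + 1 is
-- attached to the spine vertex current at time n and may then replace it.

module Submission where

open import Defs
open import Data.Empty using (⊥; ⊥-elim)
open import Data.List using (List; []; _∷_; length; map; applyUpTo)
open import Data.List.Properties using (length-map; length-applyUpTo)
open import Data.List.Relation.Binary.Sublist.Propositional using (_⊆_; []; _∷ʳ_; _∷_)
open import Data.List.Relation.Binary.Sublist.Propositional.Properties using (All-resp-⊆)
open import Data.List.Relation.Unary.All as All using (All; []; _∷_)
import Data.List.Relation.Unary.All.Properties as All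
open import Data.List.Relation.Unary.AllPairs using ([]; _∷_)
open import Data.List.Relation.Unary.Unique.Propositional using (Unique)
import Data.List.Relation.Unary.Unique.Propositional.Properties as Unique
open import Data.Nat using (ℕ; zero; suc; _+_; _*_; _⊔_; _≤_; _<_; z≤n; s≤s; s≤s⁻¹; _≤?_)
open import Data.Nat.Properties
open import Data.Product using (∃; ∃-syntax; _×_; _,_; proj₁; proj₂)
open import Data.Sum using (_⊎_; inj₁; inj₂; swap)
open import Function using (Injective; Equivalence; _∘_)
open import Function.Construct.Identity using (↔-id)
open import Level using (0ℓ)
open import Relation.Binary.Core using (Rel)
open import Relation.Binary.PropositionalEquality using (_≡_; _≢_; refl; sym; trans; cong; subst)
open import Relation.Nullary using (¬_; yes; no)
open import Relation.Nullary.Decidable using (decidable-stable; ¬¬-excluded-middle)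
open import Relation.Nullary.Negation using (DoubleNegation)
open import Relation.Unary using (Pred; _∪_; _⊢_) renaming (_⊆_ to _⇒_)

-- Bounds on cardinalities

Card≤-⊆ : {A : Set} {P Q : Pred A 0ℓ} {n : ℕ} → P ⇒ Q → Card≤ Q n → Card≤ P n
Card≤-⊆ P⇒Q Q≤n xs !xs Pxs = Q≤n xs !xs (All.map P⇒Q Pxs)

Card≤-preimage : {A B : Set} {P : Pred B 0ℓ} {n : ℕ} (f : A → B) →
                 Injective _≡_ _≡_ f → Card≤ P n → Card≤ (f ⊢ P) n
Card≤-preimage {n = n} f f-inj P≤n xs !xs Pfxs =
  subst (_≤ n) (length-map f xs) (P≤n (map f xs) (Unique.map⁺ f-inj !xs) (All.map⁺ Pfxs))

Card≤-subsingleton : {A : Set} {P : Pred A 0ℓ} →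
                     (∀ {x y} → P x → P y → x ≡ y) → Card≤ P 1
Card≤-subsingleton P! []          _                  _             = z≤n
Card≤-subsingleton P! (_ ∷ [])    _                  _             = s≤s z≤n
Card≤-subsingleton P! (_ ∷ _ ∷ _) ((x≢y ∷ _) ∷ _) (Px ∷ Py ∷ _) = ⊥-elim (x≢y (P! Px Py))

split : {A : Set} {P Q : Pred A 0ℓ} (xs : List A) → Unique xs → All (P ∪ Q) xs →
        ∃[ ys ] ∃[ zs ] ys ⊆ xs × zs ⊆ xs × Unique ys × Unique zs ×
          All P ys × All Q zs × length xs ≡ length ys + length zs
split [] [] [] = [] , [] , [] , [] , [] , [] , [] , [] , refl
split (x ∷ xs) (x∉xs ∷ !xs) (PQx ∷ PQxs) with split xs !xs PQxs | PQx
... | ys , zs , ys⊆ , zs⊆ , !ys , !zs , Pys , Qzs , eq | inj₁ Px =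
      x ∷ ys , zs , refl ∷ ys⊆ , x ∷ʳ zs⊆ , All-resp-⊆ ys⊆ x∉xs ∷ !ys , !zs ,
      Px ∷ Pys , Qzs , cong suc eq
... | ys , zs , ys⊆ , zs⊆ , !ys , !zs , Pys , Qzs , eq | inj₂ Qx =
      ys , x ∷ zs , x ∷ʳ ys⊆ , refl ∷ zs⊆ , !ys , All-resp-⊆ zs⊆ x∉xs ∷ !zs ,
      Pys , Qx ∷ Qzs , trans (cong suc eq) (sym (+-suc _ _))

Card≤-∪ : {A : Set} {P Q : Pred A 0ℓ} {m n : ℕ} →
          Card≤ P m → Card≤ Q n → Card≤ (P ∪ Q) (m + n)
Card≤-∪ P≤m Q≤n xs !xs PQxs with split xs !xs PQxs
... | ys , zs , _ , _ , !ys , !zs , Pys , Qzs , eq =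
      ≤-trans (≤-reflexive eq) (+-mono-≤ (P≤m ys !ys Pys) (Q≤n zs !zs Qzs))

Card≤-⋃ : {A : Set} {P : ℕ → Pred A 0ℓ} {s : ℕ} → (∀ t → Card≤ (P t) s) →
          ∀ n → Card≤ (λ x → ∃[ t ] t < n × P t x) (n * s)
Card≤-⋃ P≤s zero    []      _ _                   = z≤n
Card≤-⋃ P≤s zero    (_ ∷ _) _ ((_ , () , _) ∷ _)
Card≤-⋃ {P = P} P≤s (suc n) =
  Card≤-⊆ last-or-earlier (Card≤-∪ (P≤s n) (Card≤-⋃ P≤s n))
  where
  last-or-earlier : ∀ {x} → (∃[ t ] t < suc n × P t x) →
                    P n x ⊎ (∃[ t ] t < n × P t x)
  last-or-earlier (t , t<1+n , Ptx) with m≤n⇒m<n∨m≡n (s≤s⁻¹ t<1+n)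
  ... | inj₁ t<n  = inj₂ (t , t<n , Ptx)
  ... | inj₂ refl = inj₁ Ptx

Card≤-< : ∀ n → Card≤ (_< n) n
Card≤-< n = subst (Card≤ (_< n)) (*-identityʳ n)
  (Card≤-⊆ (λ {x} x<n → x , x<n , refl)
           (Card≤-⋃ {P = _≡_} (λ _ → Card≤-subsingleton λ { refl refl → refl }) n))

-- Greedy search, as `P` need not be enumerable: an element violating the current bound is new to
-- the list, joins it and raises the bound. The list cannot outgrow `n`.
uniform-bound : {A : Set} {P : Pred A 0ℓ} {n : ℕ} → Card≤ P n →
                (Q : A → ℕ → Set) → (∀ {x f g} → f ≤ g → Q x f → Q x g) →
                (∀ {x} → P x → DoubleNegation (∃ (Q x))) →
                DoubleNegation (∃[ f ] (∀ {x} → P x → DoubleNegation (Q x f)))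
uniform-bound {A} {P} {n} P≤n Q Q-up Q-bound =
  extend (suc n) [] [] [] 0 [] (≤-reflexive (sym (+-identityʳ (suc n))))
  where
  -- The fuel k counts the elements that can still be added to xs.
  extend : ∀ k xs → Unique xs → All P xs → ∀ f → All (λ x → Q x f) xs →
           suc n ≤ k + length xs →
           DoubleNegation (∃[ f ] (∀ {x} → P x → DoubleNegation (Q x f)))
  extend zero    xs !xs Pxs f Qxs n<k _ = <⇒≱ n<k (P≤n xs !xs Pxs)
  extend (suc k) xs !xs Pxs f Qxs n<k ¬bound = ¬bound (f , λ {x} Px ¬Qxf →
    Q-bound Px λ { (g , Qxg) →
      extend k (x ∷ xs)
        (All.map (λ { Qyf refl → ¬Qxf Qyf }) Qxs ∷ !xs)
        (Px ∷ Pxs) (f ⊔ g)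
        (Q-up (m≤n⊔m f g) Qxg ∷ All.map (Q-up (m≤m⊔n f g)) Qxs)
        (≤-trans n<k (≤-reflexive (sym (+-suc k (length xs)))))
        ¬bound })

-- Serves twice in `pathWidth-1`: for the supremum being attained and for the minimality of width 1.
edge⇒2≤ : {G : Graph} → ∀ {u v} → Graph.Adj G u v →
          (D : PathDecomposition G) → ∀ s → BagSizes≤ D s → 2 ≤ s
edge⇒2≤ {G} {u} {v} uv D s D≤s with PathDecomposition.covers-E D uv
... | t , u∈ , v∈ = D≤s t (u ∷ v ∷ []) ((u≢v ∷ []) ∷ [] ∷ []) (u∈ ∷ v∈ ∷ [])
  where
  u≢v : u ≢ v
  u≢v refl = Graph.loopless G u uv

-- Caterpillars

module Caterpillar
  (Full : Rel ℕ 0ℓ)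
  (Full-up : ∀ {m n o} → n ≤ o → Full m n → Full m o)
  (Full-eventually : ∀ m → DoubleNegation (∃ (Full m)))
  where

  -- Current n m: among the vertices 0, …, n, the last one on the spine is m.
  data Current : Rel ℕ 0ℓ where
    start : Current 0 0
    stay  : ∀ {n m} → Current n m → ¬ Full m (suc n) → Current (suc n) m
    move  : ∀ {n m} → Current n m → Full m (suc n) → Current (suc n) (suc n)

  Current⇒≤ : ∀ {n m} → Current n m → m ≤ n
  Current⇒≤ start      = z≤n
  Current⇒≤ (stay c _) = m≤n⇒m≤1+n (Current⇒≤ c)
  Current⇒≤ (move _ _) = ≤-refl

  Current-functional : ∀ {n m m′} → Current n m → Current n m′ → m ≡ m′
  Current-functional start start = refl
  Current-functional (stay c _)  (stay c′ _) = Current-functional c c′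
  Current-functional (stay c ¬f) (move c′ f) with refl ← Current-functional c c′ = ⊥-elim (¬f f)
  Current-functional (move c f)  (stay c′ ¬f) with refl ← Current-functional c c′ = ⊥-elim (¬f f)
  Current-functional (move _ _)  (move _ _) = refl

  Current-interval : ∀ {n m k} → m ≤ k → k ≤ n → Current n m → Current k m
  Current-interval m≤k k≤n c with m≤n⇒m<n∨m≡n k≤n
  ... | inj₂ refl = c
  Current-interval m≤k k≤n (stay c _) | inj₁ k<n = Current-interval m≤k (s≤s⁻¹ k<n) c
  -- A `move` at the last step would make `m` equal to the final time, which exceeds `k`.
  Current-interval m≤k k≤n (move _ _) | inj₁ k<n = ⊥-elim (<⇒≱ k<n m≤k)

  Current-total : ∀ n → DoubleNegation (∃ (Current n))
  Current-total zero    none = none (0 , start)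
  Current-total (suc n) none = Current-total n λ { (m , c) →
    ¬¬-excluded-middle λ where
      (yes f) → none (suc n , move c f)
      (no ¬f) → none (m , stay c ¬f) }

  -- `Full` is tested at each time from `a` on while `m` stays current; by `Full-eventually` and
  -- `Full-up` this succeeds within `b` further steps.
  Current-full : ∀ {a m} → Current a m →
                 DoubleNegation (∃[ n ] a ≤ n × Current n m × Full m (suc n))
  Current-full {a} {m} c ¬full = Full-eventually m λ { (b , f) →
    search b a c ≤-refl (Full-up (m≤n⇒m≤1+n (m≤m+n b a)) f) }
    where
    search : ∀ k n → Current n m → a ≤ n → Full m (suc (k + n)) → ⊥
    search zero    n c a≤n f = ¬full (n , a≤n , c , f)
    search (suc k) n c a≤n f = ¬¬-excluded-middle λ where
      (yes f′) → ¬full (n , a≤n , c , f′)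
      (no ¬f)  → search k (suc n) (stay c ¬f) (m≤n⇒m≤1+n a≤n)
                   (subst (Full m ∘ suc) (sym (+-suc k n)) f)

  spine-unbounded : ∀ a → DoubleNegation (∃[ n ] a ≤ n × Current n n)
  spine-unbounded a none = Current-total a λ { (m , c) →
    Current-full c λ { (n , a≤n , c′ , f) →
      none (suc n , m≤n⇒m≤1+n a≤n , move c′ f) } }

  Parent : Rel ℕ 0ℓ
  Parent m zero    = ⊥
  Parent m (suc n) = Current n m

  Parent⇒< : ∀ {m n} → Parent m n → m < n
  Parent⇒< {n = suc n} c = s≤s (Current⇒≤ c)

  graph : Graph
  graph = record
    { V         = ℕ
    ; Adj       = λ u v → Parent u v ⊎ Parent v u
    ; sym       = swap
    ; loopless  = λ { v (inj₁ p) → <-irrefl refl (Parent⇒< p)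
                    ; v (inj₂ p) → <-irrefl refl (Parent⇒< p) }
    ; countable = inj₂ (↔-id ℕ)
    }

  -- Bag `t` holds the two ends of the edge by which vertex `suc t` is attached.
  decomposition : PathDecomposition graph
  decomposition = record
    { bag      = λ t v → v ≡ suc t ⊎ Current t v
    ; covers-V = λ { zero → 0 , inj₂ start ; (suc t) → t , inj₁ refl }
    ; covers-E = covers-E
    ; interval = interval
    }
    where
    covers-E : ∀ {v w} → Parent v w ⊎ Parent w v →
               ∃[ t ] (v ≡ suc t ⊎ Current t v) × (w ≡ suc t ⊎ Current t w)
    covers-E {w = suc t} (inj₁ c) = t , inj₂ c , inj₁ refl
    covers-E {v = suc t} (inj₂ c) = t , inj₁ refl , inj₂ c

    interval : ∀ {t₁ t₂ t₃} → t₁ ≤ t₂ → t₂ ≤ t₃ → ∀ {v} →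
               v ≡ suc t₁ ⊎ Current t₁ v → v ≡ suc t₃ ⊎ Current t₃ v →
               v ≡ suc t₂ ⊎ Current t₂ v
    interval t₁≤t₂ t₂≤t₃ (inj₁ refl) (inj₁ refl) =
      inj₁ (cong suc (≤-antisym t₁≤t₂ t₂≤t₃))
    interval t₁≤t₂ t₂≤t₃ (inj₁ refl) (inj₂ c) with m≤n⇒m<n∨m≡n t₁≤t₂
    ... | inj₁ t₁<t₂ = inj₂ (Current-interval t₁<t₂ t₂≤t₃ c)
    ... | inj₂ refl  = inj₁ refl
    interval t₁≤t₂ t₂≤t₃ (inj₂ c) (inj₁ refl) =
      ⊥-elim (<⇒≱ (Current⇒≤ c) (≤-trans t₁≤t₂ t₂≤t₃))
    interval t₁≤t₂ t₂≤t₃ (inj₂ c) (inj₂ c′) =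
      inj₂ (Current-interval (≤-trans (Current⇒≤ c) t₁≤t₂) t₂≤t₃ c′)

  pathWidth-1 : HasPathWidth graph 1
  pathWidth-1 = (decomposition , bags≤2 , edge⇒2≤ {graph} 01-edge decomposition) ,
                λ D w′ (D≤ , _) → s≤s⁻¹ (edge⇒2≤ {graph} 01-edge D (suc w′) D≤)
    where
    01-edge : Graph.Adj graph 0 1
    01-edge = inj₁ start

    bags≤2 : BagSizes≤ decomposition 2
    bags≤2 t = Card≤-∪ (Card≤-subsingleton λ { refl refl → refl })
                       (Card≤-subsingleton Current-functional)

  -- Once `v` is full at `b`, it is not current beyond time `v ⊔ b`, so its children stop there; its
  -- parent is smaller.
  locallyFinite : LocallyFinite graph
  locallyFinite v ¬fin = Full-eventually v λ { (b , f) →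
    ¬fin (2 + (v ⊔ b) , Card≤-⊆ (neighbour< f) (Card≤-< (2 + (v ⊔ b)))) }
    where
    current≤ : ∀ {b n} → Full v b → Current n v → n ≤ v ⊔ b
    current≤ f start = z≤n
    current≤ {b} f (move {n} _ _) = m≤m⊔n (suc n) b
    current≤ {b} f (stay {n} _ ¬f) with suc n ≤? b
    ... | yes n<b = ≤-trans n<b (m≤n⊔m v b)
    ... | no  n≮b = ⊥-elim (¬f (Full-up (≰⇒≥ n≮b) f))

    neighbour< : ∀ {b u} → Full v b → Parent v u ⊎ Parent u v → u < 2 + (v ⊔ b)
    neighbour< {b} f (inj₂ p) = m<n⇒m<1+n (s≤s (≤-trans (<⇒≤ (Parent⇒< p)) (m≤m⊔n v b)))
    neighbour< {b} {suc n} f (inj₁ c) = s≤s (s≤s (current≤ f c))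

-- Vertices and neighbourhoods over time

module BoundedBags {U : Graph} (D : PathDecomposition U) (s : ℕ) (D≤s : BagSizes≤ D s) where

  open Graph U using (V; Adj)
  open PathDecomposition D

  Before : ℕ → Pred V 0ℓ
  Before t v = ∃[ t′ ] t′ < t × bag t′ v

  Before-up : ∀ {t u v} → t ≤ u → Before t v → Before u v
  Before-up t≤u (t′ , t′<t , v∈) = t′ , ≤-trans t′<t t≤u , v∈

  Card≤-Before : ∀ t → Card≤ (Before t) (t * s)
  Card≤-Before = Card≤-⋃ D≤s

  GoneFrom : V → ℕ → Set
  GoneFrom v f = ∀ t → f ≤ t → ¬ bag t v

  GoneFrom-up : ∀ {v f g} → f ≤ g → GoneFrom v f → GoneFrom v g
  GoneFrom-up f≤g gone t g≤t = gone t (≤-trans f≤g g≤t)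

  Persistent : Pred V 0ℓ
  Persistent v = ¬ ∃ (GoneFrom v)

  -- By `interval`, a vertex that has occurred before `T` and is missing from bag `T` is gone for
  -- good. Hence any list of persistent vertices lies in a single late bag.
  Card≤-Persistent : Card≤ Persistent s
  Card≤-Persistent xs !xs persistent =
    decidable-stable (length xs ≤? s) λ ¬≤s →
      let T , before = all-before xs in
      all-in-bag persistent before (¬≤s ∘ D≤s T xs !xs)
    where
    all-before : ∀ xs → ∃[ T ] All (Before T) xs
    all-before [] = 0 , []
    all-before (x ∷ xs) with covers-V x | all-before xs
    ... | t , x∈ | T , before =
      suc t ⊔ T , (t , m≤m⊔n (suc t) T , x∈) ∷ All.map (Before-up (m≤n⊔m (suc t) T)) before

    in-bag : ∀ {v T} → Persistent v → Before T v → DoubleNegation (bag T v)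
    in-bag {T = T} persistent (t , t<T , v∈) v∉ =
      persistent (T , λ u T≤u v∈u → v∉ (interval (<⇒≤ t<T) T≤u v∈ v∈u))

    all-in-bag : ∀ {T xs} → All Persistent xs → All (Before T) xs →
                 DoubleNegation (All (bag T) xs)
    all-in-bag [] [] k = k []
    all-in-bag (p ∷ ps) (b ∷ bs) k =
      in-bag p b λ x∈ → all-in-bag ps bs λ xs∈ → k (x∈ ∷ xs∈)

  Out : ℕ → ℕ → Set
  Out g f = g ≤ f × (∀ {v} → Before g v → ¬ Persistent v → GoneFrom v f)

  Out-total : ∀ g → DoubleNegation (∃ (Out g))
  Out-total g none =
    uniform-bound (Card≤-Before g) (λ v f → ¬ Persistent v → GoneFrom v f)
      (λ f≤g gone ¬persistent → GoneFrom-up f≤g (gone ¬persistent))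
      (λ {v} _ k → ¬¬-excluded-middle {A = ∃ (GoneFrom v)} λ where
        (yes (f , gone)) → k (f , λ _ → gone)
        (no persistent)  → k (0 , λ ¬persistent → ⊥-elim (¬persistent persistent)))
      λ { (f , gone) → none (g ⊔ f , m≤m⊔n g f , λ before ¬persistent t g⊔f≤t v∈ →
        gone before λ gone′ → gone′ ¬persistent t (≤-trans (m≤n⊔m g f) g⊔f≤t) v∈) }

  -- The bag covering the edge contains `v`, so its index is below `f`, from where `v` is gone.
  neighbour-Before : ∀ {g f v w} → Out g f → Before g v → ¬ Persistent v →
                     Adj v w → Before f w
  neighbour-Before {f = f} (_ , gone) before ¬persistent vw with covers-E vw
  ... | t , v∈ , w∈ = t , ≰⇒> (λ f≤t → gone before ¬persistent t f≤t v∈) , w∈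

  -- The base case is not equality, so that a chain from a later start also counts for an earlier
  -- one (`Out^-antitone`).
  Out^ : ℕ → ℕ → ℕ → Set
  Out^ zero    t f = t ≤ f
  Out^ (suc k) t f = ∃[ g ] Out^ k t g × Out g f

  Out^-total : ∀ k t → DoubleNegation (∃ (Out^ k t))
  Out^-total zero    t none = none (t , ≤-refl)
  Out^-total (suc k) t none = Out^-total k t λ { (g , t→g) →
    Out-total g λ { (f , g→f) → none (f , g , t→g , g→f) } }

  Out^⇒≤ : ∀ k {t f} → Out^ k t f → t ≤ f
  Out^⇒≤ zero    t≤f                 = t≤f
  Out^⇒≤ (suc k) (g , t→g , g≤f , _) = ≤-trans (Out^⇒≤ k t→g) g≤f

  Out^-antitone : ∀ k {t u f} → t ≤ u → Out^ k u f → Out^ k t f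
  Out^-antitone zero    t≤u u≤f             = ≤-trans t≤u u≤f
  Out^-antitone (suc k) t≤u (g , u→g , g→f) = g , Out^-antitone k t≤u u→g , g→f

  -- Of the `suc m` rounds, `m` suffice to follow the spine to vertex `m`, and the last reaches its
  -- children. The start `m` stands in for a start time `t₀ ≤ m` not yet known.
  Full : Rel ℕ 0ℓ
  Full m n = ∃[ f ] Out^ (suc m) m f × m + f * s < n

  Full-up : ∀ {m n o} → n ≤ o → Full m n → Full m o
  Full-up n≤o (f , m→f , <n) = f , m→f , ≤-trans <n n≤o

  Full-eventually : ∀ m → DoubleNegation (∃ (Full m))
  Full-eventually m none = Out^-total (suc m) m λ { (f , m→f) →
    none (suc (m + f * s) , f , m→f , ≤-refl) }

  open Caterpillar Full Full-up Full-eventually public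

  -- Impossibility of embedding the caterpillar

  module _ (φ : ℕ → V) (φ-injective : Injective _≡_ _≡_ φ)
           (φ-adj : ∀ {m n} → Parent m n → Adj (φ m) (φ n)) where

    -- Injectivity leaves at most `s` indices with persistent images, and so few indices are
    -- bounded.
    finally-not-Persistent : DoubleNegation (∃[ N ] ∀ {n} → N ≤ n → ¬ Persistent (φ n))
    finally-not-Persistent none =
      uniform-bound (Card≤-preimage φ φ-injective Card≤-Persistent) _<_
        (λ f≤g x<f → ≤-trans x<f f≤g)
        (λ {n} _ k → k (suc n , ≤-refl))
        λ { (N , bound) → none (N , λ N≤n persistent → bound persistent (≤⇒≯ N≤n)) }

    module _ {m₀ t₀} (¬persistent : ∀ {n} → m₀ ≤ n → ¬ Persistent (φ n))
             (m₀-spine : Current m₀ m₀) (m₀-before : Before t₀ (φ m₀)) where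

      -- Induction on the history of the spine: each `move` crosses one edge, at the cost of one
      -- round of `Out`. Labels increase along the spine, so `k ≥ m` rounds are enough. The
      -- conclusion `m₀ ≤ m` is what makes the parent non-persistent at the next `move`.
      spine-Before : ∀ {n m} → m₀ ≤ n → Current n m → ∀ {k g} → m ≤ k →
                     Out^ k t₀ g → m₀ ≤ m × Before g (φ m)
      spine-Before m₀≤n c m≤k t₀→g with m≤n⇒m<n∨m≡n m₀≤n
      spine-Before _ c {k} m≤k t₀→g | inj₂ refl
        with refl ← Current-functional c m₀-spine =
          ≤-refl , Before-up (Out^⇒≤ k t₀→g) m₀-before
      spine-Before _ (stay c _) m≤k t₀→g | inj₁ m₀<n =
        spine-Before (s≤s⁻¹ m₀<n) c m≤k t₀→g
      spine-Before m₀≤n (move c _) {suc k} (s≤s n≤k) (h , t₀→h , h→g) | inj₁ m₀<n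
        with spine-Before (s≤s⁻¹ m₀<n) c (≤-trans (Current⇒≤ c) n≤k) t₀→h
      ... | m₀≤m , before = m₀≤n , neighbour-Before h→g before (¬persistent m₀≤m) (φ-adj c)

      no-room : ∀ {p n} → m₀ ≤ p → t₀ ≤ p → Current p p → Current n p →
                ¬ Full p (suc n)
      no-room {p} {n} m₀≤p t₀≤p p-spine c (f , (g , p→g , g→f) , full) =
        -- One child more than the first `f` bags can hold.
        1+n≰n (subst (_≤ f * s) (length-applyUpTo child (suc (f * s)))
          (Card≤-Before f (applyUpTo child (suc (f * s)))
            (Unique.applyUpTo⁺₁ child (suc (f * s)) λ i<j _ eq →
              <⇒≢ i<j (+-cancelˡ-≡ p _ _ (suc-injective (φ-injective eq))))
            (All.applyUpTo⁺₁ child (suc (f * s)) child-before)))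
        where
        child : ℕ → V
        child i = φ (suc (p + i))

        p-before : Before g (φ p)
        p-before =
          proj₂ (spine-Before m₀≤p p-spine ≤-refl (Out^-antitone p t₀≤p p→g))

        child-before : ∀ {i} → i < suc (f * s) → Before f (child i)
        child-before {i} i≤ = neighbour-Before g→f p-before (¬persistent m₀≤p)
          -- `full` gives `p + f * s ≤ n`, so `p` is still current at time `p + i`.
          (φ-adj (Current-interval (m≤m+n p i)
            (≤-trans (+-monoʳ-≤ p (s≤s⁻¹ i≤)) (s≤s⁻¹ full)) c))

    no-embedding : ⊥
    no-embedding =
      finally-not-Persistent λ { (N , ¬persistent) →
      spine-unbounded N λ { (m₀ , N≤m₀ , m₀-spine) →
      let t , m₀∈ = covers-V (φ m₀) in
      -- `Before` is strict, hence the start time `suc t`.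
      spine-unbounded (m₀ ⊔ suc t) λ { (p , ≤p , p-spine) →
      Current-full p-spine λ { (n , _ , c , full) →
        no-room (λ m₀≤n → ¬persistent (≤-trans N≤m₀ m₀≤n)) m₀-spine (t , ≤-refl , m₀∈)
          (≤-trans (m≤m⊔n m₀ (suc t)) ≤p) (≤-trans (m≤n⊔m m₀ (suc t)) ≤p)
          p-spine c full } } } }

theorem4 : (U : Graph) →
    UniversalFor U (λ G → LocallyFinite G × HasPathWidth G 1) →
    HasInfinitePathWidth U
theorem4 U universal D (s , D≤s) =
  no-embedding to injective λ p →
    Subgraph.edges⊆ S (Equivalence.to (adjacency _ _) (inj₁ p))
  where
  -- The caterpillar is built against the given `D`; only then is universality applied to it.
  open BoundedBags D s D≤s
  copy = universal graph (locallyFinite , pathWidth-1)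
  S = proj₁ copy
  open IsomorphicTo (proj₂ copy)
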